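{- For every integer $t\ge 2$, with $n:=2^{t-2}$, the Erdős–Szekeres construction of $n$ points can be realized with integer coordinates: there is an Erdős–Szekeres construction for $t$, in general position, all of whose points have integer coordinates and lie in an axis-parallel square of side length $O(n^2(\log_2 n)^3)$ (as $t\to\infty$).
   Context: For finite point sets $X,Y$ in the plane, $X$ is high above $Y$ if every line determined by two points of $X$ lies strictly above every point of $Y$, and every line determined by two points of $Y$ lies strictly below every point of $X$. For positive integers $k,l$, an $S_{k,l}$-set is defined recursively: if $k\le 2$ or $l\le 2$ it is a single point; otherwise it is a set $L\cup R$ where $L$ is an $S_{k-1,l}$-set, $R$ is an $S_{k,l-1}$-set, every point of $R$ lies strictly to the right of every point of $L$, and $R$ is high above $L$. (An $S_{k,l}$-set has $\binom{k+l-4}{k-2}$ points.) An Erdős–Szekeres construction for $t$ is a point set $\bigcup_{i=0}^{t-2}A_i$, where each $A_i$ is an $S_{t-i,i+2}$-set, such that: for $i<j$ every point of $A_i$ has smaller $x$-coordinate than every point of $A_j$; every line through a point of $A_i$ and a point of $A_j$ with $i\ne j$ has negative slope; and for $0\le i<j<k\le t-2$ and any $p_i\in A_i$, $p_j\in A_j$, $p_k\in A_k$, the triple $(p_i,p_j,p_k)$ is a right (clockwise) turn. It has $2^{t-2}$ points. -}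

module Defs where

open import Data.Nat as ℕ using (ℕ; suc)
open import Data.Integer using (ℤ; +_; 0ℤ; _+_; _-_; _*_; _≤_; _<_)
open import Data.Fin as Fin using (Fin; toℕ)
open import Data.List using (List; [_]; _++_; concat; tabulate)
open import Data.List.Membership.Propositional using (_∈_)
open import Data.Product using (_×_; ∃-syntax; proj₁; proj₂)
open import Data.Sum using (_⊎_)
open import Relation.Binary.PropositionalEquality using (_≡_; _≢_)

Point : Set
Point = ℤ × ℤ

x y : Point → ℤ
x = proj₁
y = proj₂

-- det (q - p , r - p): positive for a left turn, negative for a right turn,
-- zero for collinear points.
orientation : Point → Point → Point → ℤ
orientation p q r = (x q - x p) * (y r - y p) - (y q - y p) * (x r - x p)

RightTurn : Point → Point → Point → Set
RightTurn p q r = orientation p q r < 0ℤ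

-- The line pq lies strictly above r.  When x p < x q this says
--   y r < y p + (y q - y p) / (x q - x p) * (x r - x p),
-- with the denominator cleared.  A vertical line is neither above nor below
-- any point.
LineAbove : Point → Point → Point → Set
LineAbove p q r = (x p < x q × orientation p q r < 0ℤ)
                ⊎ (x q < x p × orientation q p r < 0ℤ)

LineBelow : Point → Point → Point → Set
LineBelow p q r = (x p < x q × 0ℤ < orientation p q r)
                ⊎ (x q < x p × 0ℤ < orientation q p r)

NegativeSlope : Point → Point → Set
NegativeSlope p q = (x p < x q × y q < y p)
                  ⊎ (x q < x p × y p < y q)

-- Finite point sets are given by lists of their points.  In the constructions
-- below a union is always one of sets separated by a vertical line, so the
-- lists have no repeated entries and their length is the number of points.

HighAbove : List Point → List Point → Set
HighAbove X Y =
    (∀ {p q r} → p ∈ X → q ∈ X → p ≢ q → r ∈ Y → LineAbove p q r)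
  × (∀ {p q r} → p ∈ Y → q ∈ Y → p ≢ q → r ∈ X → LineBelow p q r)

LeftOf : List Point → List Point → Set
LeftOf X Y = ∀ {p q} → p ∈ X → q ∈ Y → x p < x q

-- S k l P : P is an S_{k,l}-set.
data S : ℕ → ℕ → List Point → Set where
  single : ∀ {k l} p → k ℕ.≤ 2 ⊎ l ℕ.≤ 2 → S k l [ p ]
  join   : ∀ {k l L R} → 2 ℕ.< suc k → 2 ℕ.< suc l →
           S k (suc l) L → S (suc k) l R →
           LeftOf L R → HighAbove R L →
           S (suc k) (suc l) (L ++ R)

-- The index type Fin (t ∸ 1) is the range 0 , … , t - 2.
record ErdősSzekeresConstruction (t : ℕ) : Set where
  field
    A             : Fin (t ℕ.∸ 1) → List Point
    A-S           : ∀ i → S (t ℕ.∸ toℕ i) (toℕ i ℕ.+ 2) (A i)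
    leftToRight   : ∀ {i j} → i Fin.< j → LeftOf (A i) (A j)
    negativeSlope : ∀ {i j p q} → i ≢ j → p ∈ A i → q ∈ A j → NegativeSlope p q
    rightTurn     : ∀ {i j k p q r} → i Fin.< j → j Fin.< k →
                    p ∈ A i → q ∈ A j → r ∈ A k → RightTurn p q r

  points : List Point
  points = concat (tabulate A)

GeneralPosition : List Point → Set
GeneralPosition P = ∀ {p q r} → p ∈ P → q ∈ P → r ∈ P →
                    p ≢ q → p ≢ r → q ≢ r → orientation p q r ≢ 0ℤ

-- A real square containing integer points can be shrunk to one whose corner
-- and side length are integers.
InSquareOfSide : ℕ → List Point → Set
InSquareOfSide s P =
  ∃[ a ] ∃[ b ] (∀ {p} → p ∈ P → (a ≤ x p × x p ≤ a + + s)
                               × (b ≤ y p × y p ≤ b + + s))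

infix 4 _=O_

_=O_ : (ℕ → ℕ) → (ℕ → ℕ) → Set
f =O g = ∃[ C ] ∃[ N ] (∀ t → N ℕ.≤ t → f t ℕ.≤ C ℕ.* g t)

{-# OPTIONS --safe #-}
module Submission where

-- An S_{k+2,l+2}-set is placed in a square of side 4 ^ (k + l) sheared by the
-- slope k + l.  Sheared by one unit of slope less, its two halves lie in
-- squares of a quarter of the side, where all slopes are negative; the right
-- half is high above the left one as soon as it lies entirely above it.  With
-- the squares three quarters of the side apart, the slopes across the gap lie
-- between 0 and 1, so one more unit of shear makes them negative again.
-- Undoing all the shears, the slopes inside a set are positive and at most
-- k + l.  With m = t - 2, the m + 1 sets all have side 4 ^ m = n ^ 2.  They are
-- attached to the points (i W , - i ^ 2 W) for W = (3 m + 1) n ^ 2, so that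
-- slopes across them are negative and the total side is O(m ^ 2 W).

open import Defs
open import Data.Fin as Fin using (Fin; zero; suc; toℕ)
import Data.Fin.Properties as Fin
open import Data.Integer as ℤ using (ℤ; +_; 0ℤ; 1ℤ; +≤+; +<+)
import Data.Integer.Properties as ℤ
open import Data.Integer.Tactic.RingSolver using (solve-∀)
open import Data.List using (List; [_]; _++_; length; concat; tabulate)
open import Data.List.Membership.Propositional using (_∈_)
open import Data.List.Membership.Propositional.Properties
  using (∈-++⁻; ∈-concat⁻′; ∈-tabulate⁻)
open import Data.List.Properties using (length-++)
open import Data.List.Relation.Unary.Any using (here)
open import Data.Nat as ℕ using (ℕ; zero; suc; s≤s; z≤n; z<s)
open import Data.Nat.Combinatorics using (_C_; nCn≡1; nCk+nC[k+1]≡[n+1]C[k+1])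
import Data.Nat.Properties as ℕ
open import Data.Nat.Tactic.RingSolver using () renaming (solve-∀ to ℕ-solve-∀)
open import Algebra.Properties.CommutativeMonoid.Sum ℕ.+-0-commutativeMonoid
  using (sum-cong-≗; sum-replicate-zero; ∑-distrib-+; sum-syntax)
open import Data.Product using (Σ-syntax; ∃-syntax; _×_; _,_; proj₁)
open import Data.Sum as Sum using (_⊎_; inj₁; inj₂)
open import Function using (_∘_)
open import Relation.Binary.Definitions using (tri<; tri≈; tri>)
open import Relation.Nullary using (yes; no; contradiction)
open import Relation.Binary.PropositionalEquality
  using (_≡_; _≢_; refl; sym; trans; cong; cong₂; subst; subst₂; ≢-sym;
         module ≡-Reasoning)
open ErdősSzekeresConstruction using (points)

module Plane where
  open import Data.Integer using (_+_; _-_; -_; _*_; _≤_; _<_)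

  -- Certifying integer inequalities.

  0<j-i⇒i<j : ∀ {i j} → 0ℤ < j - i → i < j
  0<j-i⇒i<j {i} {j} 0<j-i =
    subst₂ _<_ (ℤ.+-identityˡ i) (identity i j) (ℤ.+-monoˡ-< i 0<j-i)
    where
    identity : ∀ i j → j - i + i ≡ j
    identity = solve-∀

  i<j⇒0<j-i : ∀ {i j} → i < j → 0ℤ < j - i
  i<j⇒0<j-i {i} {j} i<j =
    subst (_< j - i) (ℤ.+-inverseʳ i) (ℤ.+-monoˡ-< (- i) i<j)

  -- The pattern for all estimates below: `d` is a sum of products whose signs are known, and the
  -- ring solver checks that it is the difference of the two sides.
  <-by : ∀ {i j d} → 0ℤ < d → j - i ≡ d → i < j
  <-by 0<d j-i≡d = 0<j-i⇒i<j (subst (0ℤ <_) (sym j-i≡d) 0<d)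

  ≤-by : ∀ {i j d} → 0ℤ ≤ d → j - i ≡ d → i ≤ j
  ≤-by 0≤d j-i≡d = ℤ.0≤i-j⇒j≤i (subst (0ℤ ≤_) (sym j-i≡d) 0≤d)

  0≤i*j : ∀ {i j} → 0ℤ ≤ i → 0ℤ ≤ j → 0ℤ ≤ i * j
  0≤i*j {+ m} {+ n} _ _ = subst (0ℤ ≤_) (ℤ.pos-* m n) (+≤+ z≤n)

  0<i*j : ∀ {i j} → 0ℤ < i → 0ℤ < j → 0ℤ < i * j
  0<i*j {+ suc m} {+ suc n} _ _ = +<+ (s≤s z≤n)
  0<i*j {+ zero} (+<+ ())
  0<i*j {+ suc m} {+ zero} _ (+<+ ())

  0≤+ : ∀ {n} → 0ℤ ≤ + n
  0≤+ = +≤+ z≤n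

  -- Shears and orientation.

  -- The second coordinate after the shear that makes lines of slope `c` horizontal.
  height : ℤ → Point → ℤ
  height c p = y p - c * x p

  -- A shear has determinant 1, so turns may be computed in sheared coordinates.
  orientation-shear : ∀ c p q r → orientation p q r ≡
    (x q - x p) * (height c r - height c p) -
    (height c q - height c p) * (x r - x p)
  orientation-shear c p q r = identity c (x p) (y p) (x q) (y q) (x r) (y r)
    where
    identity : ∀ c xp yp xq yq xr yr →
      (xq - xp) * (yr - yp) - (yq - yp) * (xr - xp) ≡
      (xq - xp) * (yr - c * xr - (yp - c * xp)) -
      (yq - c * xq - (yp - c * xp)) * (xr - xp)
    identity = solve-∀

  orientation-swap : ∀ p q r → orientation q p r ≡ - orientation p q r
  orientation-swap p q r = identity (x p) (y p) (x q) (y q) (x r) (y r)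
    where
    identity : ∀ xp yp xq yq xr yr →
      (xp - xq) * (yr - yq) - (yp - yq) * (xr - xq) ≡
      - ((xq - xp) * (yr - yp) - (yq - yp) * (xr - xp))
    identity = solve-∀

  orientation-rotate : ∀ p q r → orientation q r p ≡ orientation p q r
  orientation-rotate p q r = identity (x p) (y p) (x q) (y q) (x r) (y r)
    where
    identity : ∀ xp yp xq yq xr yr →
      (xr - xq) * (yp - yq) - (yr - yq) * (xp - xq) ≡
      (xq - xp) * (yr - yp) - (yq - yp) * (xr - xp)
    identity = solve-∀

  -- Collinearity, and general position of a single S-set.

  NonCollinear : Point → Point → Point → Set
  NonCollinear p q r = orientation p q r ≢ 0ℤ

  swap-nonCollinear : ∀ p q r → NonCollinear p q r → NonCollinear q p r
  swap-nonCollinear p q r pqr≢0 qpr≡0 =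
    pqr≢0 (ℤ.neg-injective (trans (sym (orientation-swap p q r)) qpr≡0))

  rotate-nonCollinear : ∀ p q r → NonCollinear p q r → NonCollinear q r p
  rotate-nonCollinear p q r pqr≢0 qrp≡0 =
    pqr≢0 (trans (sym (orientation-rotate p q r)) qrp≡0)

  lineAbove⇒nonCollinear : ∀ p q r → LineAbove p q r → NonCollinear p q r
  lineAbove⇒nonCollinear p q r (inj₁ (_ , turn)) = ℤ.<⇒≢ turn
  lineAbove⇒nonCollinear p q r (inj₂ (_ , turn)) =
    swap-nonCollinear q p r (ℤ.<⇒≢ turn)

  lineBelow⇒nonCollinear : ∀ p q r → LineBelow p q r → NonCollinear p q r
  lineBelow⇒nonCollinear p q r (inj₁ (_ , turn)) = ≢-sym (ℤ.<⇒≢ turn)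
  lineBelow⇒nonCollinear p q r (inj₂ (_ , turn)) =
    swap-nonCollinear q p r (≢-sym (ℤ.<⇒≢ turn))

  ∈-singleton-unique : ∀ {o p q : Point} → p ∈ [ o ] → q ∈ [ o ] → p ≡ q
  ∈-singleton-unique (here refl) (here refl) = refl

  -- A triple split between the halves has two points in one of them, and `HighAbove` keeps the line
  -- through these two off the third. Rotations bring that pair to the front.
  S-generalPosition : ∀ {k l P} → S k l P → GeneralPosition P
  S-generalPosition (single o _) p∈ q∈ _ p≢q _ _ =
    contradiction (∈-singleton-unique p∈ q∈) p≢q
  S-generalPosition (join {L = L} {R} _ _ SL SR _ (above , below))
                    {p} {q} {r} p∈ q∈ r∈ p≢q p≢r q≢r
    with ∈-++⁻ L p∈ | ∈-++⁻ L q∈ | ∈-++⁻ L r∈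
  ... | inj₁ p∈L | inj₁ q∈L | inj₁ r∈L =
    S-generalPosition SL p∈L q∈L r∈L p≢q p≢r q≢r
  ... | inj₂ p∈R | inj₂ q∈R | inj₂ r∈R =
    S-generalPosition SR p∈R q∈R r∈R p≢q p≢r q≢r
  ... | inj₁ p∈L | inj₁ q∈L | inj₂ r∈R =
    lineBelow⇒nonCollinear p q r (below p∈L q∈L p≢q r∈R)
  ... | inj₂ p∈R | inj₂ q∈R | inj₁ r∈L =
    lineAbove⇒nonCollinear p q r (above p∈R q∈R p≢q r∈L)
  ... | inj₁ p∈L | inj₂ q∈R | inj₂ r∈R =
    rotate-nonCollinear r p q (rotate-nonCollinear q r p
      (lineAbove⇒nonCollinear q r p (above q∈R r∈R q≢r p∈L)))
  ... | inj₂ p∈R | inj₁ q∈L | inj₁ r∈L =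
    rotate-nonCollinear r p q (rotate-nonCollinear q r p
      (lineBelow⇒nonCollinear q r p (below q∈L r∈L q≢r p∈R)))
  ... | inj₁ p∈L | inj₂ q∈R | inj₁ r∈L =
    rotate-nonCollinear r p q
      (lineBelow⇒nonCollinear r p q (below r∈L p∈L (≢-sym p≢r) q∈R))
  ... | inj₂ p∈R | inj₁ q∈L | inj₂ r∈R =
    rotate-nonCollinear r p q
      (lineAbove⇒nonCollinear r p q (above r∈R p∈R (≢-sym p≢r) q∈L))

  -- Sheared boxes and turns.

  -- The last field says that the slope of pq is less than c.
  record Ascends (c : ℤ) (p q : Point) : Set where
    constructor ascends
    field
      x< : x p < x q
      y< : y p < y q
      h> : height c q < height c p

  -- A square of side B sheared by the slope c, with o its upper left corner.
  record InBox (c B : ℤ) (o p : Point) : Set where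
    field
      x≥ : x o ≤ x p
      x< : x p < x o + B
      h> : height c o - B < height c p
      h≤ : height c p ≤ height c o

  corner-inBox : ∀ {c B} o → 0ℤ < B → InBox c B o o
  corner-inBox {c} {B} o 0<B = record
    { x≥ = ℤ.≤-refl
    ; x< = <-by 0<B (cancel₁ (x o) B)
    ; h> = <-by 0<B (cancel₂ (height c o) B)
    ; h≤ = ℤ.≤-refl
    }
    where
    cancel₁ : ∀ i b → i + b - i ≡ b
    cancel₁ = solve-∀
    cancel₂ : ∀ i b → i - (i - b) ≡ b
    cancel₂ = solve-∀

  ascends-mono : ∀ {c p q} → Ascends c p q → Ascends (1ℤ + c) p q
  ascends-mono {c} {p} {q} (ascends x< y< h>) = ascends x< y<
    (<-by (ℤ.+-mono-< (i<j⇒0<j-i h>) (i<j⇒0<j-i x<))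
          (identity c (x p) (y p) (x q) (y q)))
    where
    identity : ∀ c xp yp xq yq →
      yp - (1ℤ + c) * xp - (yq - (1ℤ + c) * xq) ≡
      yp - c * xp - (yq - c * xq) + (xq - xp)
    identity = solve-∀

  module _ (c : ℤ) (p q r : Point) where
    -- In sheared coordinates the line `pq` falls, so to the left of `p` it runs above both its
    -- points, while `r` is lower than both.
    turn-below : Ascends c p q → x r < x p → height c r < height c q →
                 orientation p q r < 0ℤ
    turn-below (ascends p<q _ hq<hp) r<p hr<hq = <-by
      (ℤ.+-mono-<
        (0<i*j (i<j⇒0<j-i p<q) (i<j⇒0<j-i hr<hq))
        (0<i*j (i<j⇒0<j-i hq<hp)
               (ℤ.+-mono-< (i<j⇒0<j-i p<q) (i<j⇒0<j-i r<p))))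
      (trans (cong (_-_ 0ℤ) (orientation-shear c p q r))
        (identity (x p) (height c p) (x q) (height c q) (x r) (height c r)))
      where
      identity : ∀ xp hp xq hq xr hr →
        0ℤ - ((xq - xp) * (hr - hp) - (hq - hp) * (xr - xp)) ≡
        (xq - xp) * (hq - hr) +
        (hp - hq) * (xq - xp + (xp - xr))
      identity = solve-∀

    -- To the right of `q` the falling sheared line `pq` runs below both its points, while `r` is
    -- higher than `p`.
    turn-above : Ascends c p q → x q < x r → height c p < height c r →
                 0ℤ < orientation p q r
    turn-above (ascends p<q _ hq<hp) q<r hp<hr = <-by
      (ℤ.+-mono-<
        (0<i*j (i<j⇒0<j-i p<q) (i<j⇒0<j-i hp<hr))
        (0<i*j (i<j⇒0<j-i hq<hp) (i<j⇒0<j-i (ℤ.<-trans p<q q<r))))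
      (trans (cong (_- 0ℤ) (orientation-shear c p q r))
        (identity (x p) (height c p) (x q) (height c q) (x r) (height c r)))
      where
      identity : ∀ xp hp xq hq xr hr →
        (xq - xp) * (hr - hp) - (hq - hp) * (xr - xp) - 0ℤ ≡
        (xq - xp) * (hr - hp) + (hp - hq) * (xr - xp)
      identity = solve-∀

    -- In sheared coordinates the path climbs to `q` and then descends.
    turn-peak : x p < x q → x q < x r →
                height c p < height c q → height c r < height c q →
                RightTurn p q r
    turn-peak p<q q<r hp<hq hr<hq = <-by
      (ℤ.+-mono-<
        (0<i*j (i<j⇒0<j-i p<q) (i<j⇒0<j-i hr<hq))
        (0<i*j (i<j⇒0<j-i hp<hq) (i<j⇒0<j-i q<r)))
      (trans (cong (_-_ 0ℤ) (orientation-shear c p q r))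
        (identity (x p) (height c p) (x q) (height c q) (x r) (height c r)))
      where
      identity : ∀ xp hp xq hq xr hr →
        0ℤ - ((xq - xp) * (hr - hp) - (hq - hp) * (xr - xp)) ≡
        (xq - xp) * (hq - hr) + (hq - hp) * (xr - xq)
      identity = solve-∀

  -- Joining two boxes into one of four times the side.

  -- Upper left corner of the box for the right half. After the shear by `c` it is `B` higher than
  -- `o`, so the right box begins at exactly the height where the left one ends.
  corner : ℤ → ℤ → Point → Point
  corner c B o = x o + + 3 * B , y o + B + c * (+ 3 * B)

  height-corner : ∀ c B o → height c (corner c B o) ≡ height c o + B
  height-corner c B o = identity c B (x o) (y o)
    where
    identity : ∀ c b xo yo →
      yo + b + c * (+ 3 * b) - c * (xo + + 3 * b) ≡
      yo - c * xo + b
    identity = solve-∀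

  height-suc : ∀ c p → height (1ℤ + c) p ≡ height c p - x p
  height-suc c p = identity c (x p) (y p)
    where
    identity : ∀ c xp yp → yp - (1ℤ + c) * xp ≡ yp - c * xp - xp
    identity = solve-∀

  module _ {c B : ℤ} {o : Point} (0<B : 0ℤ < B) where
    private
      0≤B : 0ℤ ≤ B
      0≤B = ℤ.<⇒≤ 0<B

      0<2B : 0ℤ < + 2 * B
      0<2B = 0<i*j {+ 2} (+<+ (s≤s z≤n)) 0<B

      0≤3B : 0ℤ ≤ + 3 * B
      0≤3B = 0≤i*j {+ 3} 0≤+ 0≤B

    inBox-left : ∀ {p} → InBox c B o p → InBox (1ℤ + c) (+ 4 * B) o p
    inBox-left {p} box = record
      { x≥ = x≥
      ; x< = <-by (ℤ.+-mono-<-≤ 0<right 0≤3B) (right (x o) (x p) B)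
      ; h> = <-by (ℤ.+-mono-< (ℤ.+-mono-< (i<j⇒0<j-i h>) 0<right) 0<2B)
                  (trans (cong₂ (λ i j → i - (j - + 4 * B))
                                (height-suc c p) (height-suc c o))
                         (bottom (x o) (height c o) (x p) (height c p) B))
      ; h≤ = ≤-by (ℤ.+-mono-≤ (ℤ.i≤j⇒0≤j-i h≤) (ℤ.i≤j⇒0≤j-i x≥))
                  (trans (cong₂ _-_ (height-suc c o) (height-suc c p))
                         (top (x o) (height c o) (x p) (height c p)))
      }
      where
      open InBox box
      0<right : 0ℤ < x o + B - x p
      0<right = i<j⇒0<j-i x<
      right : ∀ xo xp b → xo + + 4 * b - xp ≡ xo + b - xp + + 3 * b
      right = solve-∀
      bottom : ∀ xo ho xp hp b → hp - xp - (ho - xo - + 4 * b) ≡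
        hp - (ho - b) + (xo + b - xp) + + 2 * b
      bottom = solve-∀
      top : ∀ xo ho xp hp → ho - xo - (hp - xp) ≡ ho - hp + (xp - xo)
      top = solve-∀

    -- For the slope `1 + c`, moving `3B` to the right costs `3B` of height against the gain of `B`,
    -- so the corner drops by `2B`. The box itself spans at most another `2B`, which just reaches
    -- the lower edge.
    inBox-right : ∀ {p} → InBox c B (corner c B o) p →
                  InBox (1ℤ + c) (+ 4 * B) o p
    inBox-right {p} box = record
      { x≥ = ≤-by (ℤ.+-mono-≤ 0≤left 0≤3B) (left (x o) (x p) B)
      ; x< = <-by 0<right (right (x o) (x p) B)
      ; h> = <-by (ℤ.+-mono-< (i<j⇒0<j-i h>) 0<right)
                  (trans (cong₂ (λ i j → i - (j - + 4 * B))
                                (height-suc c p) (height-suc c o))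
                         -- The solver sees the height of the shifted corner as `height c o + B`;
                         -- `height-corner` converts between the two forms.
                         (trans (bottom (x o) (height c o) (x p) (height c p) B)
                                (cong (λ h → height c p - (h - B) + _)
                                      (sym (height-corner c B o)))))
      ; h≤ = ≤-by (ℤ.+-mono-≤ (ℤ.+-mono-≤ (ℤ.i≤j⇒0≤j-i h≤) 0≤left)
                              (ℤ.<⇒≤ 0<2B))
                  (trans (cong₂ _-_ (height-suc c o) (height-suc c p))
                         (trans (top (x o) (height c o) (x p) (height c p) B)
                                (cong (λ h → h - height c p + _ + _)
                                      (sym (height-corner c B o)))))
      }
      where
      open InBox box
      0≤left : 0ℤ ≤ x p - (x o + + 3 * B)
      0≤left = ℤ.i≤j⇒0≤j-i x≥
      0<right : 0ℤ < x o + + 3 * B + B - x p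
      0<right = i<j⇒0<j-i x<
      left : ∀ xo xp b → xp - xo ≡ xp - (xo + + 3 * b) + + 3 * b
      left = solve-∀
      right : ∀ xo xp b → xo + + 4 * b - xp ≡ xo + + 3 * b + b - xp
      right = solve-∀
      bottom : ∀ xo ho xp hp b → hp - xp - (ho - xo - + 4 * b) ≡
        hp - (ho + b - b) + (xo + + 3 * b + b - xp)
      bottom = solve-∀
      top : ∀ xo ho xp hp b → ho - xo - (hp - xp) ≡
        ho + b - hp + (xp - (xo + + 3 * b)) + + 2 * b
      top = solve-∀

    module _ {p q} (boxˡ : InBox c B o p) (boxʳ : InBox c B (corner c B o) q) where
      private
        module L = InBox boxˡ
        module R = InBox boxʳ

        0<gap : 0ℤ < x q - (x o + + 3 * B) + (x o + B - x p)
        0<gap = ℤ.+-mono-≤-< (ℤ.i≤j⇒0≤j-i R.x≥) (i<j⇒0<j-i L.x<)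

      left-of-right : x p < x q
      left-of-right = <-by (ℤ.+-mono-< 0<gap 0<2B) (identity (x o) (x p) (x q) B)
        where
        identity : ∀ xo xp xq b →
          xq - xp ≡ xq - (xo + + 3 * b) + (xo + b - xp) + + 2 * b
        identity = solve-∀

      left-below-right : height c p < height c q
      left-below-right = <-by
        (ℤ.+-mono-<-≤ (i<j⇒0<j-i R.h>) (ℤ.i≤j⇒0≤j-i L.h≤))
        (trans (identity (height c o) (height c p) (height c q) B)
               (cong (λ h → height c q - (h - B) + _)
                     (sym (height-corner c B o))))
        where
        identity : ∀ ho hp hq b → hq - hp ≡ hq - (ho + b - b) + (ho - hp)
        identity = solve-∀

      -- The horizontal distance exceeds `2B`, and the sheared height rises by more than 0 and less
      -- than `2B`, so the true slope lies between `c` and `1 + c`. It is positive because `0 ≤ c`.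
      ascends-across : 0ℤ ≤ c → Ascends (1ℤ + c) p q
      ascends-across 0≤c = ascends left-of-right
        (<-by (ℤ.+-mono-<-≤ (i<j⇒0<j-i left-below-right)
                (0≤i*j 0≤c (ℤ.i≤j⇒0≤j-i (ℤ.<⇒≤ left-of-right))))
              (rise c (x p) (y p) (x q) (y q)))
        (<-by (ℤ.+-mono-<-≤ (ℤ.+-mono-< 0<gap (i<j⇒0<j-i L.h>))
                            (ℤ.i≤j⇒0≤j-i R.h≤))
              (trans (cong₂ _-_ (height-suc c p) (height-suc c q))
                (trans (drop (x o) (height c o) (x p) (height c p)
                             (x q) (height c q) B)
                       (cong (λ h → x q - (x o + + 3 * B) + (x o + B - x p) +
                                    (height c p - (height c o - B)) +
                                    (h - height c q))
                             (sym (height-corner c B o))))))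
        where
        rise : ∀ c xp yp xq yq → yq - yp ≡
          yq - c * xq - (yp - c * xp) + c * (xq - xp)
        rise = solve-∀
        drop : ∀ xo ho xp hp xq hq b → hp - xp - (hq - xq) ≡
          xq - (xo + + 3 * b) + (xo + b - xp) + (hp - (ho - b)) + (ho + b - hq)
        drop = solve-∀

  -- The recursive S-sets.

  -- The power of 4 in recursive form, so that the enlarged box of `inBox-left` has the next size by
  -- computation.
  size : ℕ → ℤ
  size zero    = 1ℤ
  size (suc d) = + 4 * size d

  0<size : ∀ d → 0ℤ < size d
  0<size zero    = +<+ z<s
  0<size (suc d) = 0<i*j {+ 4} (+<+ z<s) (0<size d)

  -- Indices are those of `S` less two. Both halves have the index sum `k + suc l`, hence boxes of
  -- equal size and shear.
  staircase : ℕ → ℕ → Point → List Point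
  staircase zero    l       o = [ o ]
  staircase (suc k) zero    o = [ o ]
  staircase (suc k) (suc l) o =
    staircase k (suc l) o ++
    staircase (suc k) l (corner (+ (k ℕ.+ suc l)) (size (k ℕ.+ suc l)) o)

  staircase-inBox : ∀ k l {o p} → p ∈ staircase k l o →
                    InBox (+ (k ℕ.+ l)) (size (k ℕ.+ l)) o p
  -- The right half has index sum `suc k + l`, equal to `k + suc l` only up to a transport, which is
  -- isolated here.
  staircase-inBoxʳ : ∀ k l {o p} → p ∈ staircase (suc k) l o →
                     InBox (+ (k ℕ.+ suc l)) (size (k ℕ.+ suc l)) o p

  staircase-inBox zero    l    (here refl) = corner-inBox _ (0<size l)
  staircase-inBox (suc k) zero (here refl) = corner-inBox _ (0<size (suc k ℕ.+ 0))
  staircase-inBox (suc k) (suc l) {o} p∈ with ∈-++⁻ (staircase k (suc l) o) p∈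
  ... | inj₁ p∈L = inBox-left (0<size (k ℕ.+ suc l)) (staircase-inBox k (suc l) p∈L)
  ... | inj₂ p∈R = inBox-right (0<size (k ℕ.+ suc l)) (staircase-inBoxʳ k l p∈R)

  staircase-inBoxʳ k l {o} {p} p∈ =
    subst (λ d → InBox (+ d) (size d) o p) (sym (ℕ.+-suc k l))
          (staircase-inBox (suc k) l p∈)

  Comparable : ℤ → Point → Point → Set
  Comparable c p q = Ascends c p q ⊎ Ascends c q p

  staircase-comparable : ∀ k l {o p q} → p ∈ staircase k l o →
    q ∈ staircase k l o → p ≢ q → Comparable (+ (k ℕ.+ l)) p q
  staircase-comparableʳ : ∀ k l {o p q} → p ∈ staircase (suc k) l o →
    q ∈ staircase (suc k) l o → p ≢ q → Comparable (+ (k ℕ.+ suc l)) p q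

  staircase-comparable zero l p∈ q∈ p≢q =
    contradiction (∈-singleton-unique p∈ q∈) p≢q
  staircase-comparable (suc k) zero p∈ q∈ p≢q =
    contradiction (∈-singleton-unique p∈ q∈) p≢q
  staircase-comparable (suc k) (suc l) {o} p∈ q∈ p≢q
    with ∈-++⁻ (staircase k (suc l) o) p∈ | ∈-++⁻ (staircase k (suc l) o) q∈
  ... | inj₁ p∈L | inj₁ q∈L =
    Sum.map ascends-mono ascends-mono (staircase-comparable k (suc l) p∈L q∈L p≢q)
  ... | inj₂ p∈R | inj₂ q∈R =
    Sum.map ascends-mono ascends-mono (staircase-comparableʳ k l p∈R q∈R p≢q)
  ... | inj₁ p∈L | inj₂ q∈R = inj₁ (ascends-across (0<size (k ℕ.+ suc l))
    (staircase-inBox k (suc l) p∈L) (staircase-inBoxʳ k l q∈R) 0≤+)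
  ... | inj₂ p∈R | inj₁ q∈L = inj₂ (ascends-across (0<size (k ℕ.+ suc l))
    (staircase-inBox k (suc l) q∈L) (staircase-inBoxʳ k l p∈R) 0≤+)

  staircase-comparableʳ k l {p = p} {q} p∈ q∈ p≢q =
    subst (λ d → Comparable (+ d) p q) (sym (ℕ.+-suc k l))
          (staircase-comparable (suc k) l p∈ q∈ p≢q)

  -- After the shear by `d`, all lines inside either half fall, and the left half lies lower and to
  -- the left. Hence `turn-below` and `turn-above` apply to every pair in one half and point of the
  -- other.
  staircase-S : ∀ k l o → S (2 ℕ.+ k) (2 ℕ.+ l) (staircase k l o)
  staircase-S zero    l    o = single o (inj₁ ℕ.≤-refl)
  staircase-S (suc k) zero o = single o (inj₂ ℕ.≤-refl)
  staircase-S (suc k) (suc l) o = join (s≤s (s≤s z<s)) (s≤s (s≤s z<s))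
    (staircase-S k (suc l) o) (staircase-S (suc k) l o′)
    left (above , below)
    where
    d = k ℕ.+ suc l
    o′ = corner (+ d) (size d) o
    left : LeftOf (staircase k (suc l) o) (staircase (suc k) l o′)
    left p∈ q∈ = left-of-right (0<size d)
      (staircase-inBox k (suc l) p∈) (staircase-inBoxʳ k l q∈)
    lower : ∀ {p q} → p ∈ staircase k (suc l) o → q ∈ staircase (suc k) l o′ →
            height (+ d) p < height (+ d) q
    lower p∈ q∈ = left-below-right (0<size d)
      (staircase-inBox k (suc l) p∈) (staircase-inBoxʳ k l q∈)
    above : ∀ {p q r} → p ∈ staircase (suc k) l o′ → q ∈ staircase (suc k) l o′ →
            p ≢ q → r ∈ staircase k (suc l) o → LineAbove p q r
    above {p} {q} {r} p∈ q∈ p≢q r∈ with staircase-comparableʳ k l p∈ q∈ p≢q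
    ... | inj₁ asc = inj₁ (Ascends.x< asc ,
      turn-below (+ d) p q r asc (left r∈ p∈) (lower r∈ q∈))
    ... | inj₂ asc = inj₂ (Ascends.x< asc ,
      turn-below (+ d) q p r asc (left r∈ q∈) (lower r∈ p∈))
    below : ∀ {p q r} → p ∈ staircase k (suc l) o → q ∈ staircase k (suc l) o →
            p ≢ q → r ∈ staircase (suc k) l o′ → LineBelow p q r
    below {p} {q} {r} p∈ q∈ p≢q r∈ with staircase-comparable k (suc l) p∈ q∈ p≢q
    ... | inj₁ asc = inj₁ (Ascends.x< asc ,
      turn-above (+ d) p q r asc (left q∈ r∈) (lower p∈ r∈))
    ... | inj₂ asc = inj₂ (Ascends.x< asc ,
      turn-above (+ d) q p r asc (left p∈ r∈) (lower q∈ r∈))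

  -- Blocks along a parabola.

  0≤gap : ∀ {i j} → i ℕ.< j → 0ℤ ≤ + j - + i - 1ℤ
  0≤gap {i} {j} i<j = subst (0ℤ ≤_) (identity (+ i) (+ j)) (ℤ.i≤j⇒0≤j-i (+≤+ i<j))
    where
    identity : ∀ i j → j - (1ℤ + i) ≡ j - i - 1ℤ
    identity = solve-∀

  -- With `d` the positive one of the two differences, this is `(d - 1) * (d + 1)`.
  0≤i²-1 : ∀ {i j} → i ≢ j → 0ℤ ≤ (+ j - + i) * (+ j - + i) - 1ℤ
  0≤i²-1 {i} {j} i≢j with ℕ.<-cmp i j
  ... | tri≈ _ i≡j _ = contradiction i≡j i≢j
  ... | tri< i<j _ _ = subst (0ℤ ≤_) (sym (identity (+ i) (+ j)))
    (0≤i*j (0≤gap i<j) (ℤ.+-mono-≤ (0≤gap i<j) (0≤+ {2})))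
    where
    identity : ∀ i j → (j - i) * (j - i) - 1ℤ ≡ (j - i - 1ℤ) * (j - i - 1ℤ + + 2)
    identity = solve-∀
  ... | tri> _ _ j<i = subst (0ℤ ≤_) (sym (identity (+ i) (+ j)))
    (0≤i*j (0≤gap j<i) (ℤ.+-mono-≤ (0≤gap j<i) (0≤+ {2})))
    where
    identity : ∀ i j → (j - i) * (j - i) - 1ℤ ≡ (i - j - 1ℤ) * (i - j - 1ℤ + + 2)
    identity = solve-∀

  -- The corners of the blocks lie on the parabola y = - x ^ 2 / W, whose
  -- tangent at the j-th corner has slope - 2 j.  A block varies in height above
  -- this tangent direction by less than W, the least drop to another corner.
  module Arch (m : ℕ) where
    M N W : ℤ
    M = + m
    N = size m
    W = (+ 3 * M + 1ℤ) * N

    base : ℕ → Point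
    base i = + i * W , - (+ i * + i * W)

    InBlock : ℕ → Point → Set
    InBlock i = InBox M N (base i)

    0≤M : 0ℤ ≤ M
    0≤M = 0≤+

    0<N : 0ℤ < N
    0<N = 0<size m

    0≤N : 0ℤ ≤ N
    0≤N = ℤ.<⇒≤ 0<N

    0≤W : 0ℤ ≤ W
    0≤W = 0≤i*j (ℤ.+-mono-≤ (0≤i*j {+ 3} 0≤+ 0≤M) (0≤+ {1})) 0≤N

    module Block {i p} (box : InBlock i p) where
      open InBox box
      0≤left : 0ℤ ≤ x p - + i * W
      0≤left = ℤ.i≤j⇒0≤j-i x≥
      0<right : 0ℤ < + i * W + N - x p
      0<right = i<j⇒0<j-i x<
      0<bottom : 0ℤ < height M p - (height M (base i) - N)
      0<bottom = i<j⇒0<j-i h>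
      0≤top : 0ℤ ≤ height M (base i) - height M p
      0≤top = ℤ.i≤j⇒0≤j-i h≤

    module _ {i j p q} (boxᵢ : InBlock i p) (boxⱼ : InBlock j q) where
      private
        module P = Block {i} boxᵢ
        module Q = Block {j} boxⱼ

      block-left : i ℕ.< j → x p < x q
      block-left i<j = <-by
        (ℤ.+-mono-<-≤ (ℤ.+-mono-≤-< Q.0≤left P.0<right)
          (ℤ.+-mono-≤ (0≤i*j (0≤gap i<j) 0≤W)
                      (0≤i*j (0≤i*j {+ 3} 0≤+ 0≤M) 0≤N)))
        (identity M N (+ i) (+ j) (x p) (x q))
        where
        identity : ∀ M N I J xp xq → let W = (+ 3 * M + 1ℤ) * N in
          xq - xp ≡ xq - J * W + (I * W + N - xp) +
                    ((J - I - 1ℤ) * W + + 3 * M * N)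
        identity = solve-∀

      -- The corners drop by at least `W`. The boxes win back less than `N + M * N`: `N` below the
      -- first corner and `M * N` above the second. A margin of `2 * M * N` remains.
      block-above : i ℕ.< j → y q < y p
      block-above i<j = <-by
        (ℤ.+-mono-<-≤
          (ℤ.+-mono-<-≤ (ℤ.+-mono-<-≤ P.0<bottom Q.0≤top)
            (0≤i*j 0≤M (ℤ.+-mono-≤ P.0≤left (ℤ.<⇒≤ Q.0<right))))
          (ℤ.+-mono-≤
            (0≤i*j 0≤W (ℤ.+-mono-≤
              (ℤ.+-mono-≤ (0≤i*j (0≤gap i<j) (ℤ.+-mono-≤ (0≤+ {j}) (0≤+ {i})))
                          (0≤gap i<j))
              (0≤i*j {+ 2} 0≤+ (0≤+ {i}))))
            (0≤i*j (0≤i*j {+ 2} 0≤+ 0≤M) 0≤N)))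
        (identity M N (+ i) (+ j) (x p) (y p) (x q) (y q))
        where
        identity : ∀ M N I J xp yp xq yq →
          let W  = (+ 3 * M + 1ℤ) * N
              Hᵢ = - (I * I * W) - M * (I * W)
              Hⱼ = - (J * J * W) - M * (J * W)
          in yp - yq ≡
            yp - M * xp - (Hᵢ - N) + (Hⱼ - (yq - M * xq)) +
            M * (xp - I * W + (J * W + N - xq)) +
            (W * ((J - I - 1ℤ) * (J + I) + (J - I - 1ℤ) + + 2 * I) +
             + 2 * M * N)
        identity = solve-∀

      -- The `i`-th corner lies `(j - i) ^ 2 * W` below the tangent at the `j`-th. Since
      -- `y + 2jx = (y - Mx) + (M + 2j)x`, the boxes account for less than `N + (M + 2j) * N`, which
      -- is at most `W` because `j ≤ m`. This fixes the factor `3 * M + 1` in `W`.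
      block-peak : i ≢ j → j ℕ.≤ m →
                   height (- (+ 2 * + j)) p < height (- (+ 2 * + j)) q
      block-peak i≢j j≤m = <-by
        (ℤ.+-mono-<-≤
          (ℤ.+-mono-<-≤ (ℤ.+-mono-<-≤ Q.0<bottom P.0≤top)
            (0≤i*j (ℤ.+-mono-≤ 0≤M (0≤i*j {+ 2} 0≤+ (0≤+ {j})))
                   (ℤ.+-mono-≤ Q.0≤left (ℤ.<⇒≤ P.0<right))))
          (0≤i*j 0≤N (ℤ.+-mono-≤
            (0≤i*j (ℤ.+-mono-≤ (0≤i*j {+ 3} 0≤+ 0≤M) (0≤+ {1})) (0≤i²-1 i≢j))
            (0≤i*j {+ 2} 0≤+ (ℤ.i≤j⇒0≤j-i (+≤+ j≤m))))))
        (identity M N (+ i) (+ j) (x p) (y p) (x q) (y q))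
        where
        identity : ∀ M N I J xp yp xq yq →
          let W  = (+ 3 * M + 1ℤ) * N
              Hᵢ = - (I * I * W) - M * (I * W)
              Hⱼ = - (J * J * W) - M * (J * W)
          in yq - - (+ 2 * J) * xq - (yp - - (+ 2 * J) * xp) ≡
            yq - M * xq - (Hⱼ - N) + (Hᵢ - (yp - M * xp)) +
            (M + + 2 * J) * (xq - J * W + (I * W + N - xp)) +
            N * ((+ 3 * M + 1ℤ) * ((J - I) * (J - I) - 1ℤ) + + 2 * (M - J))
        identity = solve-∀

    -- Deliberately crude: the corners reach down to `- M * M * W`, and spare multiples of `W`
    -- absorb the extent of the boxes.
    side lowest : ℤ
    side   = (M * M + M + + 2) * W
    lowest = - ((M * M + 1ℤ) * W)

    block-inSquare : ∀ {i p} → i ℕ.≤ m → InBlock i p →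
      (0ℤ ≤ x p × x p ≤ 0ℤ + side) × (lowest ≤ y p × y p ≤ lowest + side)
    block-inSquare {i} {p} i≤m box =
      ( ≤-by (ℤ.+-mono-≤ 0≤left (0≤i*j (0≤+ {i}) 0≤W))
             (x-lower M N (+ i) (x p))
      , ≤-by (ℤ.+-mono-≤ (ℤ.<⇒≤ 0<right)
               (ℤ.+-mono-≤ (0≤i*j (ℤ.+-mono-≤ 0≤M-I (ℤ.+-mono-≤ 0≤M² (0≤+ {1}))) 0≤W)
                           0≤3MN))
             (x-upper M N (+ i) (x p)) ) ,
      ( ≤-by (ℤ.+-mono-≤ (ℤ.+-mono-≤ (ℤ.<⇒≤ 0<bottom) (0≤i*j 0≤M 0≤left))
               (ℤ.+-mono-≤ (0≤i*j 0≤W (0≤i*j 0≤M-I (ℤ.+-mono-≤ 0≤M (0≤+ {i}))))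
                           0≤3MN))
             (y-lower M N (+ i) (x p) (y p))
      , ≤-by (ℤ.+-mono-≤ (ℤ.+-mono-≤ 0≤top (0≤i*j 0≤M (ℤ.<⇒≤ 0<right)))
               (ℤ.+-mono-≤
                 (0≤i*j (ℤ.+-mono-≤ 0≤M (0≤i*j (0≤+ {i}) (0≤+ {i}))) 0≤W)
                 (0≤i*j (ℤ.+-mono-≤ (0≤i*j {+ 2} 0≤+ 0≤M) (0≤+ {1})) 0≤N)))
             (y-upper M N (+ i) (x p) (y p)) )
      where
      open Block {i} box
      0≤M-I : 0ℤ ≤ M - + i
      0≤M-I = ℤ.i≤j⇒0≤j-i (+≤+ i≤m)
      0≤M² : 0ℤ ≤ M * M
      0≤M² = 0≤i*j 0≤M 0≤M
      0≤3MN : 0ℤ ≤ + 3 * M * N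
      0≤3MN = 0≤i*j (0≤i*j {+ 3} 0≤+ 0≤M) 0≤N
      x-lower : ∀ M N I xp → let W = (+ 3 * M + 1ℤ) * N in
        xp - 0ℤ ≡ xp - I * W + I * W
      x-lower = solve-∀
      x-upper : ∀ M N I xp → let W = (+ 3 * M + 1ℤ) * N in
        0ℤ + (M * M + M + + 2) * W - xp ≡
        I * W + N - xp + ((M - I + (M * M + 1ℤ)) * W + + 3 * M * N)
      x-upper = solve-∀
      y-lower : ∀ M N I xp yp →
        let W = (+ 3 * M + 1ℤ) * N
            H = - (I * I * W) - M * (I * W)
        in yp - - ((M * M + 1ℤ) * W) ≡
           yp - M * xp - (H - N) + M * (xp - I * W) +
           (W * ((M - I) * (M + I)) + + 3 * M * N)
      y-lower = solve-∀
      y-upper : ∀ M N I xp yp →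
        let W = (+ 3 * M + 1ℤ) * N
            H = - (I * I * W) - M * (I * W)
        in - ((M * M + 1ℤ) * W) + (M * M + M + + 2) * W - yp ≡
           H - (yp - M * xp) + M * (I * W + N - xp) +
           ((M + I * I) * W + (+ 2 * M + 1ℤ) * N)
      y-upper = solve-∀

    block-rightTurn : ∀ {i j k p q r} → i ℕ.< j → j ℕ.< k → j ℕ.≤ m →
      InBlock i p → InBlock j q → InBlock k r → RightTurn p q r
    block-rightTurn {i} {j} {k} {p} {q} {r} i<j j<k j≤m boxᵢ boxⱼ boxₖ =
      turn-peak (- (+ 2 * + j)) p q r
        (block-left {i} {j} boxᵢ boxⱼ i<j) (block-left {j} {k} boxⱼ boxₖ j<k)
        (block-peak {i} {j} boxᵢ boxⱼ (ℕ.<⇒≢ i<j) j≤m)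
        (block-peak {k} {j} boxₖ boxⱼ (≢-sym (ℕ.<⇒≢ j<k)) j≤m)

  -- The falling segments place `r` either to the lower right or to the upper left of both `p` and
  -- `q`, so it is strictly on one side of the rising line `pq`. The mixed cases contradict the
  -- order of `p` and `q`.
  ascends-negativeSlope⇒nonCollinear : ∀ {c} p q r → Ascends c p q →
    NegativeSlope p r → NegativeSlope q r → NonCollinear p q r
  ascends-negativeSlope⇒nonCollinear p q r (ascends p<q yp<yq _)
    (inj₁ (_ , yr<yp)) (inj₁ (q<r , _)) = ℤ.<⇒≢ (<-by
      (ℤ.+-mono-< (0<i*j (i<j⇒0<j-i p<q) (i<j⇒0<j-i yr<yp))
                  (0<i*j (i<j⇒0<j-i yp<yq) (i<j⇒0<j-i (ℤ.<-trans p<q q<r))))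
      (identity (x p) (y p) (x q) (y q) (x r) (y r)))
    where
    identity : ∀ xp yp xq yq xr yr →
      0ℤ - ((xq - xp) * (yr - yp) - (yq - yp) * (xr - xp)) ≡
      (xq - xp) * (yp - yr) + (yq - yp) * (xr - xp)
    identity = solve-∀
  ascends-negativeSlope⇒nonCollinear p q r (ascends p<q yp<yq _)
    (inj₂ (r<p , _)) (inj₂ (_ , yq<yr)) = ≢-sym (ℤ.<⇒≢ (<-by
      (ℤ.+-mono-< (0<i*j (i<j⇒0<j-i p<q) (i<j⇒0<j-i (ℤ.<-trans yp<yq yq<yr)))
                  (0<i*j (i<j⇒0<j-i yp<yq) (i<j⇒0<j-i r<p)))
      (identity (x p) (y p) (x q) (y q) (x r) (y r))))
    where
    identity : ∀ xp yp xq yq xr yr →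
      (xq - xp) * (yr - yp) - (yq - yp) * (xr - xp) - 0ℤ ≡
      (xq - xp) * (yr - yp) + (yq - yp) * (xp - xr)
    identity = solve-∀
  ascends-negativeSlope⇒nonCollinear p q r (ascends p<q yp<yq _)
    (inj₁ (_ , yr<yp)) (inj₂ (_ , yq<yr)) =
    contradiction (ℤ.<-trans yp<yq yq<yr) (ℤ.<-asym yr<yp)
  ascends-negativeSlope⇒nonCollinear p q r (ascends p<q yp<yq _)
    (inj₂ (r<p , _)) (inj₁ (q<r , _)) =
    contradiction (ℤ.<-trans p<q q<r) (ℤ.<-asym r<p)

  -- The side length as a natural number.

  size≡4^ : ∀ d → size d ≡ + (4 ℕ.^ d)
  size≡4^ zero    = refl
  size≡4^ (suc d) =
    trans (cong (+ 4 *_) (size≡4^ d)) (sym (ℤ.pos-* 4 (4 ℕ.^ d)))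

  sideLength : ℕ → ℕ
  sideLength m = (m ℕ.* m ℕ.+ m ℕ.+ 2) ℕ.* ((3 ℕ.* m ℕ.+ 1) ℕ.* 4 ℕ.^ m)

  side≡sideLength : ∀ m → Arch.side m ≡ + sideLength m
  side≡sideLength m = sym (trans (ℤ.pos-* (m ℕ.* m ℕ.+ m ℕ.+ 2) _)
    (cong₂ _*_ (cong (λ i → i + + m + + 2) (ℤ.pos-* m m))
      (trans (ℤ.pos-* (3 ℕ.* m ℕ.+ 1) _)
        (cong₂ _*_ (cong (_+ 1ℤ) (ℤ.pos-* 3 m)) (sym (size≡4^ m))))))

open Plane
open import Data.Nat using (_+_; _*_; _^_; _∸_; _≤_; _<_)
open import Data.Nat.Logarithm using (⌊log₂_⌋; ⌊log₂[2^n]⌋≡n)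

-- Counting points.

staircase-length : ∀ k l o → length (staircase k l o) ≡ (k + l) C l
staircase-length zero    l    o = sym (nCn≡1 l)
staircase-length (suc k) zero o = refl
staircase-length (suc k) (suc l) o = begin
  length (staircase k (suc l) o ++ staircase (suc k) l _)
    ≡⟨ length-++ (staircase k (suc l) o) ⟩
  length (staircase k (suc l) o) + length (staircase (suc k) l _)
    ≡⟨ cong₂ _+_ (staircase-length k (suc l) o) (staircase-length (suc k) l _) ⟩
  (k + suc l) C suc l + (suc k + l) C l
    ≡⟨ cong (λ n → (k + suc l) C suc l + n C l) (ℕ.+-suc k l) ⟨
  (k + suc l) C suc l + (k + suc l) C l
    ≡⟨ ℕ.+-comm ((k + suc l) C suc l) _ ⟩
  (k + suc l) C l + (k + suc l) C suc l
    ≡⟨ nCk+nC[k+1]≡[n+1]C[k+1] (k + suc l) l ⟩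
  suc (k + suc l) C suc l ∎
  where open ≡-Reasoning

-- Terms beyond `n` vanish. The number of terms is left free because Pascal's rule splits the sum
-- into two of different lengths.
∑C≡2^ : ∀ {n N} → n < N → ∑[ i < N ] (n C toℕ i) ≡ 2 ^ n
∑C≡2^ {zero}  {suc N} _ = cong suc (sum-replicate-zero N)
∑C≡2^ {suc n} {suc N} (s≤s n<N) = begin
  1 + ∑[ i < N ] (suc n C suc (toℕ i))
    ≡⟨ cong suc (sum-cong-≗ (λ i → nCk+nC[k+1]≡[n+1]C[k+1] n (toℕ {N} i))) ⟨
  1 + ∑[ i < N ] (n C toℕ i + n C suc (toℕ i))
    ≡⟨ cong suc (∑-distrib-+ {N} (λ i → n C toℕ i) _) ⟩
  1 + (∑[ i < N ] (n C toℕ i) + ∑[ i < N ] (n C suc (toℕ i)))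
    -- The leading 1 becomes the term `n C 0` of the second sum.
    ≡⟨ ℕ.+-suc (∑[ i < N ] (n C toℕ i)) _ ⟨
  ∑[ i < N ] (n C toℕ i) + ∑[ i < suc N ] (n C toℕ i)
    ≡⟨ cong₂ _+_ (∑C≡2^ n<N) (∑C≡2^ (ℕ.m<n⇒m<1+n n<N)) ⟩
  2 ^ n + 2 ^ n
    ≡⟨ cong (λ j → 2 ^ n + j) (ℕ.+-identityʳ (2 ^ n)) ⟨
  2 ^ suc n ∎
  where open ≡-Reasoning

length-concat-tabulate : ∀ {a} {X : Set a} {n} (f : Fin n → List X) →
  length (concat (tabulate f)) ≡ ∑[ i < n ] length (f i)
length-concat-tabulate {n = zero}  f = refl
length-concat-tabulate {n = suc n} f = trans (length-++ (f zero))
  (cong (λ j → length (f zero) + j) (length-concat-tabulate (f ∘ suc)))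

∈-concat-tabulate⁻ : ∀ {a} {X : Set a} {n} (f : Fin n → List X) {v} →
  v ∈ concat (tabulate f) → ∃[ i ] v ∈ f i
∈-concat-tabulate⁻ f v∈ with ∈-concat⁻′ (tabulate f) v∈
... | _ , v∈xs , xs∈ with ∈-tabulate⁻ {f = f} xs∈
... | i , refl = i , v∈xs

-- General position of the union.

Increasing : Point → Point → Set
Increasing p q = ∃[ c ] Ascends c p q

module _ {t : ℕ} (E : ErdősSzekeresConstruction t)
  (comparable : ∀ {i p q} → p ∈ ErdősSzekeresConstruction.A E i →
                q ∈ ErdősSzekeresConstruction.A E i → p ≢ q →
                Increasing p q ⊎ Increasing q p)
  where

  open ErdősSzekeresConstruction E hiding (points)

  -- The case that needs `comparable`: lines inside a block rise, whereas lines between blocks fall.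
  two-one : ∀ {i j p q r} → i ≢ j → p ∈ A i → q ∈ A i → r ∈ A j → p ≢ q →
            NonCollinear p q r
  two-one {p = p} {q} {r} i≢j p∈ q∈ r∈ p≢q with comparable p∈ q∈ p≢q
  ... | inj₁ (_ , asc) = ascends-negativeSlope⇒nonCollinear p q r asc
    (negativeSlope i≢j p∈ r∈) (negativeSlope i≢j q∈ r∈)
  ... | inj₂ (_ , asc) = swap-nonCollinear q p r
    (ascends-negativeSlope⇒nonCollinear q p r asc
      (negativeSlope i≢j q∈ r∈) (negativeSlope i≢j p∈ r∈))

  ordered : ∀ {i j k p q r} → i Fin.< j → j Fin.< k →
            p ∈ A i → q ∈ A j → r ∈ A k → NonCollinear p q r
  ordered i<j j<k p∈ q∈ r∈ = ℤ.<⇒≢ (rightTurn i<j j<k p∈ q∈ r∈)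

  one-one-one : ∀ {i j k p q r} → i ≢ j → i ≢ k → j ≢ k →
                p ∈ A i → q ∈ A j → r ∈ A k → NonCollinear p q r
  one-one-one {i} {j} {k} {p} {q} {r} i≢j i≢k j≢k p∈ q∈ r∈
    with Fin.<-cmp i j | Fin.<-cmp j k | Fin.<-cmp i k
  ... | tri≈ _ i≡j _ | _ | _ = contradiction i≡j i≢j
  ... | _ | tri≈ _ j≡k _ | _ = contradiction j≡k j≢k
  ... | _ | _ | tri≈ _ i≡k _ = contradiction i≡k i≢k
  ... | tri< i<j _ _ | tri< j<k _ _ | _ = ordered i<j j<k p∈ q∈ r∈
  ... | tri< _ _ _ | tri> _ _ k<j | tri< i<k _ _ =
    rotate-nonCollinear r p q
      (swap-nonCollinear p r q (ordered i<k k<j p∈ r∈ q∈))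
  ... | tri< i<j _ _ | tri> _ _ _ | tri> _ _ k<i =
    rotate-nonCollinear r p q (ordered k<i i<j r∈ p∈ q∈)
  ... | tri> _ _ j<i | tri< _ _ _ | tri< i<k _ _ =
    swap-nonCollinear q p r (ordered j<i i<k q∈ p∈ r∈)
  ... | tri> _ _ _ | tri< j<k _ _ | tri> _ _ k<i =
    rotate-nonCollinear r p q
      (rotate-nonCollinear q r p (ordered j<k k<i q∈ r∈ p∈))
  ... | tri> _ _ j<i | tri> _ _ k<j | _ =
    rotate-nonCollinear r p q (rotate-nonCollinear q r p
      (swap-nonCollinear r q p (ordered k<j j<i r∈ q∈ p∈)))

  increasingBlocks⇒generalPosition : GeneralPosition (points E)
  increasingBlocks⇒generalPosition {p} {q} {r} p∈ q∈ r∈ p≢q p≢r q≢r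
    with ∈-concat-tabulate⁻ A p∈ | ∈-concat-tabulate⁻ A q∈
       | ∈-concat-tabulate⁻ A r∈
  ... | i , p∈i | j , q∈j | k , r∈k with i Fin.≟ j | j Fin.≟ k | i Fin.≟ k
  ... | yes refl | yes refl | _ =
    S-generalPosition (A-S i) p∈i q∈j r∈k p≢q p≢r q≢r
  ... | yes refl | no j≢k | _ = two-one j≢k p∈i q∈j r∈k p≢q
  ... | no i≢j | yes refl | _ = rotate-nonCollinear r p q
    (rotate-nonCollinear q r p (two-one (≢-sym i≢j) q∈j r∈k p∈i q≢r))
  ... | no i≢j | no _ | yes refl = rotate-nonCollinear r p q
    (two-one i≢j r∈k p∈i q∈j (≢-sym p≢r))
  ... | no i≢j | no j≢k | no i≢k = one-one-one i≢j i≢k j≢k p∈i q∈j r∈k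

-- Assembling the construction for `t = m + 2`.

module Construction (m : ℕ) where
  open Arch m

  block : Fin (suc m) → List Point
  block i = staircase (m ∸ toℕ i) (toℕ i) (base (toℕ i))

  -- All blocks thus share the box size `N` and the slope bound `M`, although they differ in their
  -- number of points.
  depth : ∀ (i : Fin (suc m)) → m ∸ toℕ i + toℕ i ≡ m
  depth i = ℕ.m∸n+n≡m (Fin.toℕ≤pred[n] i)

  inBlock : ∀ i {p} → p ∈ block i → InBlock (toℕ i) p
  inBlock i {p} p∈ =
    subst (λ d → InBox (+ d) (size d) (base (toℕ i)) p) (depth i)
          (staircase-inBox (m ∸ toℕ i) (toℕ i) p∈)

  separated : ∀ {i j p q} → i Fin.< j → p ∈ block i → q ∈ block j →
              x p ℤ.< x q × y q ℤ.< y p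
  separated {i} {j} i<j p∈ q∈ =
    block-left {toℕ i} {toℕ j} (inBlock i p∈) (inBlock j q∈) i<j ,
    block-above {toℕ i} {toℕ j} (inBlock i p∈) (inBlock j q∈) i<j

  construction : ErdősSzekeresConstruction (2 + m)
  construction = record
    { A = block
    ; A-S = λ i → subst₂ (λ k l → S k l (block i))
        (sym (ℕ.+-∸-assoc 2 (Fin.toℕ≤pred[n] i))) (ℕ.+-comm 2 (toℕ i))
        (staircase-S (m ∸ toℕ i) (toℕ i) (base (toℕ i)))
    ; leftToRight = λ i<j p∈ q∈ → proj₁ (separated i<j p∈ q∈)
    ; negativeSlope = slope
    ; rightTurn = λ {i} {j} {k} {p} {q} {r} i<j j<k p∈ q∈ r∈ →
        block-rightTurn {toℕ i} {toℕ j} {toℕ k} {p} {q} {r}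
          i<j j<k (Fin.toℕ≤pred[n] j)
          (inBlock i p∈) (inBlock j q∈) (inBlock k r∈)
    }
    where
    slope : ∀ {i j p q} → i ≢ j → p ∈ block i → q ∈ block j → NegativeSlope p q
    slope {i} {j} i≢j p∈ q∈ with Fin.<-cmp i j
    ... | tri< i<j _ _ = inj₁ (separated i<j p∈ q∈)
    ... | tri≈ _ i≡j _ = contradiction i≡j i≢j
    ... | tri> _ _ j<i = inj₂ (separated j<i q∈ p∈)

  generalPosition : GeneralPosition (points construction)
  generalPosition = increasingBlocks⇒generalPosition construction
    (λ {i} p∈ q∈ p≢q → Sum.map (_ ,_) (_ ,_)
      (staircase-comparable (m ∸ toℕ i) (toℕ i) p∈ q∈ p≢q))

  length-points : length (points construction) ≡ 2 ^ m
  length-points = begin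
    length (concat (tabulate block))
      ≡⟨ length-concat-tabulate block ⟩
    ∑[ i < suc m ] length (block i)
      ≡⟨ sum-cong-≗ {suc m} (λ i → staircase-length (m ∸ toℕ i) (toℕ i) (base (toℕ i))) ⟩
    ∑[ i < suc m ] ((m ∸ toℕ i + toℕ i) C toℕ i)
      ≡⟨ sum-cong-≗ {suc m} (λ i → cong (_C toℕ i) (depth i)) ⟩
    ∑[ i < suc m ] (m C toℕ i)
      ≡⟨ ∑C≡2^ (ℕ.n<1+n m) ⟩
    2 ^ m ∎
    where open ≡-Reasoning

  inSquare : InSquareOfSide (sideLength m) (points construction)
  inSquare = 0ℤ , lowest , bounds
    where
    bounds : ∀ {p} → p ∈ points construction →
      (0ℤ ℤ.≤ x p × x p ℤ.≤ 0ℤ ℤ.+ + sideLength m) ×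
      (lowest ℤ.≤ y p × y p ℤ.≤ lowest ℤ.+ + sideLength m)
    bounds {p} p∈ with ∈-concat-tabulate⁻ block p∈
    ... | i , p∈i = subst
      (λ s → (0ℤ ℤ.≤ x p × x p ℤ.≤ 0ℤ ℤ.+ s) × (lowest ℤ.≤ y p × y p ℤ.≤ lowest ℤ.+ s))
      (side≡sideLength m)
      (block-inSquare {toℕ i} (Fin.toℕ≤pred[n] i) (inBlock i p∈i))

-- The asymptotic bound.

sideLength≤ : ∀ k → let m = suc k ; n = 2 ^ m in
  sideLength m ≤ 16 * (n ^ 2 * ⌊log₂ n ⌋ ^ 3)
sideLength≤ k = begin
  (m * m + m + 2) * ((3 * m + 1) * 4 ^ m)
    ≤⟨ ℕ.m≤m+n _ _ ⟩
  (m * m + m + 2) * ((3 * m + 1) * 4 ^ m) +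
  -- The expansion in `k` of `16 * m ^ 3 - (m * m + m + 2) * (3 * m + 1)`. It vanishes at `k = 0`,
  -- so 16 is the least constant that works from `m = 1` on.
  (13 * (k * k * k) + 35 * (k * k) + 24 * k) * 4 ^ m
    ≡⟨ identity k (4 ^ m) ⟩
  16 * (4 ^ m * m ^ 3)
    ≡⟨ cong (λ i → 16 * (i * m ^ 3)) 4^m≡n² ⟩
  16 * (n ^ 2 * m ^ 3)
    ≡⟨ cong (λ i → 16 * (n ^ 2 * i ^ 3)) (⌊log₂[2^n]⌋≡n m) ⟨
  16 * (n ^ 2 * ⌊log₂ n ⌋ ^ 3) ∎
  where
  open ℕ.≤-Reasoning
  m = suc k
  n = 2 ^ m
  4^m≡n² : 4 ^ m ≡ n ^ 2
  4^m≡n² = trans (ℕ.^-*-assoc 2 2 m)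
    (trans (cong (2 ^_) (ℕ.*-comm 2 m)) (sym (ℕ.^-*-assoc 2 m 2)))
  identity : ∀ k N →
    ((1 + k) * (1 + k) + (1 + k) + 2) * ((3 * (1 + k) + 1) * N) +
    (13 * (k * k * k) + 35 * (k * k) + 24 * k) * N ≡
    16 * (N * ((1 + k) * ((1 + k) * ((1 + k) * 1))))
  identity = ℕ-solve-∀

theorem4 : Σ[ side ∈ (ℕ → ℕ) ]
    ( (∀ t → 2 ≤ t →
    Σ[ E ∈ ErdősSzekeresConstruction t ]
    ( length (points E) ≡ 2 ^ (t ∸ 2)
    × GeneralPosition (points E)
    × InSquareOfSide (side t) (points E) ))
    × side =O (λ t → let n = 2 ^ (t ∸ 2) in n ^ 2 * ⌊log₂ n ⌋ ^ 3) )
-- The bound starts at `t = 3`: for `t = 2` the logarithm is 0 while the side is 2.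
theorem4 = (λ t → sideLength (t ∸ 2)) , realization , 16 , 3 , bound
  where
  realization : ∀ t → 2 ≤ t →
    Σ[ E ∈ ErdősSzekeresConstruction t ]
    ( length (points E) ≡ 2 ^ (t ∸ 2)
    × GeneralPosition (points E)
    × InSquareOfSide (sideLength (t ∸ 2)) (points E) )
  realization (suc zero) (s≤s ())
  realization (suc (suc m)) _ = construction , length-points , generalPosition , inSquare
    where open Construction m
  bound : ∀ t → 3 ≤ t → let n = 2 ^ (t ∸ 2) in
    sideLength (t ∸ 2) ≤ 16 * (n ^ 2 * ⌊log₂ n ⌋ ^ 3)
  bound (suc zero) (s≤s ())
  bound (suc (suc zero)) (s≤s (s≤s ()))
  bound (suc (suc (suc k))) _ = sideLength≤ k
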